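{- Let $\mathrm{pa16}_3$ be the sentence $\forall x\,\exists q\,\exists r\,(r<3\land x=q\cdot3+r)$. Then $$\mathrm{PA}_{\mathrm{smu}}^{ - }\cup\operatorname{Th}_{\forall}(\mathfrak N_0)\nvdash\mathrm{pa16}_3.$$ Consequently, $\mathrm{PA}_{\mathrm{smu}}^{ - }\cup\operatorname{Th}_{\forall}(\mathfrak N_0)$ does not prove the scheme $\mathrm{pa16}$ (that is, it does not prove all of its instances); in particular, neither does $\mathrm{PA}_{\mathrm{smu}}^{ - }$.
   Context: The base language is $\mathcal L_0=\{0,1,+,\cdot,\le\}$ (first-order logic with equality). Abbreviations: $2:=1+1$; $3:=2+1$; $x<y$ means $x\le y\land x\ne y$; $x\mid y$ means $\exists z\,(z\cdot x=y)$; $\operatorname{pow}_2(x)$ means $\forall y\,(y\mid x\rightarrow(y=1\lor 2\mid y))$. $\mathrm{PA}_{\mathrm{smu}}^{ - }$ is the $\mathcal L_0$-theory whose axioms are the universal closures of: (pa1) $x+0=x$; (pa2) $x+y=y+x$; (pa3) $(x+y)+z=x+(y+z)$; (pa4) $x\cdot1=x$; (pa5) $x\cdot y=y\cdot x$; (pa6) $(x\cdot y)\cdot z=x\cdot(y\cdot z)$; (pa7) $x\cdot(y+z)=x\cdot y+x\cdot z$; (pa8) $x\le y\lor y\le x$; (pa9) $(x\le y\land y\le z)\rightarrow x\le z$; (pa10) $\neg(x+1\le x)$; (pa11) $y\le x\rightarrow(y=x\lor y+1\le x)$; (pa12) $y\le x\rightarrow y+z\le x+z$; (pa13) $y\le x\rightarrow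 y\cdot z\le x\cdot z$; (pa15) $y\le x\rightarrow\exists z\,(x=y+z)$; (pa19) $\exists u\,(\operatorname{pow}_2(u)\land u\le x+1\land x+1<2\cdot u)$; (pa20) $(\operatorname{pow}_2(x)\land\operatorname{pow}_2(y)\land x\le y)\rightarrow x\mid y$. $\mathfrak N_0=(\mathbb N;0,1,+,\cdot,\le)$ is the standard model ($0\in\mathbb N$). $\operatorname{Th}_{\forall}(\mathfrak N_0)$ is the set of all universal $\mathcal L_0$-sentences (a block of universal quantifiers followed by a quantifier-free formula) true in $\mathfrak N_0$. $\overline n$ denotes the $\mathcal L_0$-numeral for the standard natural number $n$. The Standard Euclidean Division Principle $\mathrm{pa16}$ is the scheme consisting, for every $n\in\mathbb N\setminus\{0\}$, of the sentence $\forall x\,\exists q\,\exists r\,(r<\overline n\land x=q\cdot\overline n+r)$; $\mathrm{pa16}_3$ is its $n=3$ instance. $\vdash$ is provability in first-order logic with equality. -}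

module Defs where

open import Data.Nat using (ℕ; zero; suc; NonZero) renaming (_+_ to _+ℕ_; _*_ to _*ℕ_; _≤_ to _≤ℕ_)
open import Data.Fin using (Fin; zero; suc)
open import Data.List using (List; []; _∷_; map)
open import Data.List.Membership.Propositional using (_∈_)
import Data.Vec.Functional as Vector
open import Data.Empty using (⊥)
open import Data.Product using (Σ; _×_)
open import Data.Sum using (_⊎_)
open import Function using (_∘_)
open import Level using (0ℓ)
open import Relation.Binary.PropositionalEquality using (_≡_; refl)
open import Relation.Nullary using (¬_)
open import Relation.Unary using (Pred)

infixl 7 _∙_
infixl 6 _⊕_
infix  5 _≈_ _≼_ _≺_ _∣_
infix  4 ~_
infixr 3 _∧_
infixr 2 _∨_
infixr 1 _⇒_
infix  0 _⊢_ _⊬_ _∣_⊢_ _⊨_ _⊢pa16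

-- The index n bounds the free variables, which are de Bruijn indices.

data Term (n : ℕ) : Set where
  var     : Fin n → Term n
  𝟘 𝟙     : Term n
  _⊕_ _∙_ : Term n → Term n → Term n

data Formula : ℕ → Set where
  _≈_ _≼_     : ∀ {n} → Term n → Term n → Formula n
  ⊥'          : ∀ {n} → Formula n
  _∧_ _∨_ _⇒_ : ∀ {n} → Formula n → Formula n → Formula n
  ∀' ∃'       : ∀ {n} → Formula (suc n) → Formula n

Sentence : Set
Sentence = Formula 0

Theory : Set₁
Theory = Pred Sentence 0ℓ

~_ : ∀ {n} → Formula n → Formula n
~ φ = φ ⇒ ⊥'

Subst : ℕ → ℕ → Set
Subst m n = Fin m → Term n

substₜ : ∀ {m n} → Subst m n → Term m → Term n
substₜ σ (var i) = σ i
substₜ σ 𝟘       = 𝟘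
substₜ σ 𝟙       = 𝟙
substₜ σ (s ⊕ t) = substₜ σ s ⊕ substₜ σ t
substₜ σ (s ∙ t) = substₜ σ s ∙ substₜ σ t

wkₜ : ∀ {n} → Term n → Term (suc n)
wkₜ = substₜ (var ∘ suc)

lift : ∀ {m n} → Subst m n → Subst (suc m) (suc n)
lift σ zero    = var zero
lift σ (suc i) = wkₜ (σ i)

subst : ∀ {m n} → Subst m n → Formula m → Formula n
subst σ (s ≈ t) = substₜ σ s ≈ substₜ σ t
subst σ (s ≼ t) = substₜ σ s ≼ substₜ σ t
subst σ ⊥'      = ⊥'
subst σ (φ ∧ ψ) = subst σ φ ∧ subst σ ψ
subst σ (φ ∨ ψ) = subst σ φ ∨ subst σ ψ
subst σ (φ ⇒ ψ) = subst σ φ ⇒ subst σ ψ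
subst σ (∀' φ)  = ∀' (subst (lift σ) φ)
subst σ (∃' φ)  = ∃' (subst (lift σ) φ)

wk : ∀ {n} → Formula n → Formula (suc n)
wk = subst (var ∘ suc)

_[_] : ∀ {n} → Formula (suc n) → Term n → Formula n
φ [ t ] = subst (t Vector.∷ var) φ

close : ∀ {n} → Sentence → Formula n
close = subst Vector.[]

-- Classical natural deduction from the axioms T under the open assumptions Γ.
-- Eigenvariable conditions are expressed by weakening.
data _∣_⊢_ (T : Theory) {n : ℕ} (Γ : List (Formula n)) : Formula n → Set where
  axiom  : ∀ {φ} → T φ → T ∣ Γ ⊢ close φ
  assume : ∀ {φ} → φ ∈ Γ → T ∣ Γ ⊢ φ
  ⇒-I    : ∀ {φ ψ} → T ∣ φ ∷ Γ ⊢ ψ → T ∣ Γ ⊢ φ ⇒ ψ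
  ⇒-E    : ∀ {φ ψ} → T ∣ Γ ⊢ φ ⇒ ψ → T ∣ Γ ⊢ φ → T ∣ Γ ⊢ ψ
  ∧-I    : ∀ {φ ψ} → T ∣ Γ ⊢ φ → T ∣ Γ ⊢ ψ → T ∣ Γ ⊢ φ ∧ ψ
  ∧-E₁   : ∀ {φ ψ} → T ∣ Γ ⊢ φ ∧ ψ → T ∣ Γ ⊢ φ
  ∧-E₂   : ∀ {φ ψ} → T ∣ Γ ⊢ φ ∧ ψ → T ∣ Γ ⊢ ψ
  ∨-I₁   : ∀ {φ ψ} → T ∣ Γ ⊢ φ → T ∣ Γ ⊢ φ ∨ ψ
  ∨-I₂   : ∀ {φ ψ} → T ∣ Γ ⊢ ψ → T ∣ Γ ⊢ φ ∨ ψ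
  ∨-E    : ∀ {φ ψ χ} → T ∣ Γ ⊢ φ ∨ ψ → T ∣ φ ∷ Γ ⊢ χ → T ∣ ψ ∷ Γ ⊢ χ → T ∣ Γ ⊢ χ
  raa    : ∀ {φ} → T ∣ (~ φ) ∷ Γ ⊢ ⊥' → T ∣ Γ ⊢ φ
  ∀-I    : ∀ {φ} → T ∣ map wk Γ ⊢ φ → T ∣ Γ ⊢ ∀' φ
  ∀-E    : ∀ {φ} → T ∣ Γ ⊢ ∀' φ → (t : Term n) → T ∣ Γ ⊢ φ [ t ]
  ∃-I    : ∀ {φ} (t : Term n) → T ∣ Γ ⊢ φ [ t ] → T ∣ Γ ⊢ ∃' φ
  ∃-E    : ∀ {φ ψ} → T ∣ Γ ⊢ ∃' φ → T ∣ φ ∷ map wk Γ ⊢ wk ψ → T ∣ Γ ⊢ ψ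
  ≈-refl : ∀ {t} → T ∣ Γ ⊢ t ≈ t
  ≈-subst : ∀ (φ : Formula (suc n)) {s t} → T ∣ Γ ⊢ s ≈ t → T ∣ Γ ⊢ φ [ s ] → T ∣ Γ ⊢ φ [ t ]

_⊢_ : Theory → Sentence → Set
T ⊢ φ = T ∣ [] ⊢ φ

_⊬_ : Theory → Sentence → Set
T ⊬ φ = ¬ (T ⊢ φ)

record Structure : Set₁ where
  field
    Carrier : Set
    0# 1#   : Carrier
    _+_ _*_ : Carrier → Carrier → Carrier
    _≤_     : Carrier → Carrier → Set

module Semantics (M : Structure) where
  open Structure M

  Env : ℕ → Set
  Env = Vector.Vector Carrier

  ⟦_⟧ₜ : ∀ {n} → Term n → Env n → Carrier
  ⟦ var i ⟧ₜ ρ = ρ i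
  ⟦ 𝟘 ⟧ₜ     ρ = 0#
  ⟦ 𝟙 ⟧ₜ     ρ = 1#
  ⟦ s ⊕ t ⟧ₜ ρ = ⟦ s ⟧ₜ ρ + ⟦ t ⟧ₜ ρ
  ⟦ s ∙ t ⟧ₜ ρ = ⟦ s ⟧ₜ ρ * ⟦ t ⟧ₜ ρ

  ⟦_⟧ : ∀ {n} → Formula n → Env n → Set
  ⟦ s ≈ t ⟧ ρ = ⟦ s ⟧ₜ ρ ≡ ⟦ t ⟧ₜ ρ
  ⟦ s ≼ t ⟧ ρ = ⟦ s ⟧ₜ ρ ≤ ⟦ t ⟧ₜ ρ
  ⟦ ⊥' ⟧    ρ = ⊥
  ⟦ φ ∧ ψ ⟧ ρ = ⟦ φ ⟧ ρ × ⟦ ψ ⟧ ρ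
  ⟦ φ ∨ ψ ⟧ ρ = ⟦ φ ⟧ ρ ⊎ ⟦ ψ ⟧ ρ
  ⟦ φ ⇒ ψ ⟧ ρ = ⟦ φ ⟧ ρ → ⟦ ψ ⟧ ρ
  ⟦ ∀' φ ⟧  ρ = (a : Carrier) → ⟦ φ ⟧ (a Vector.∷ ρ)
  ⟦ ∃' φ ⟧  ρ = Σ Carrier λ a → ⟦ φ ⟧ (a Vector.∷ ρ)

_⊨_ : Structure → Sentence → Set
M ⊨ φ = Semantics.⟦_⟧ M φ Vector.[]

𝔑₀ : Structure
𝔑₀ = record { Carrier = ℕ ; 0# = 0 ; 1# = 1 ; _+_ = _+ℕ_ ; _*_ = _*ℕ_ ; _≤_ = _≤ℕ_ }

data QuantifierFree {n : ℕ} : Formula n → Set where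
  qf-≈ : ∀ {s t} → QuantifierFree (s ≈ t)
  qf-≼ : ∀ {s t} → QuantifierFree (s ≼ t)
  qf-⊥ : QuantifierFree ⊥'
  qf-∧ : ∀ {φ ψ} → QuantifierFree φ → QuantifierFree ψ → QuantifierFree (φ ∧ ψ)
  qf-∨ : ∀ {φ ψ} → QuantifierFree φ → QuantifierFree ψ → QuantifierFree (φ ∨ ψ)
  qf-⇒ : ∀ {φ ψ} → QuantifierFree φ → QuantifierFree ψ → QuantifierFree (φ ⇒ ψ)

data Universal : ∀ {n} → Formula n → Set where
  matrix : ∀ {n} {φ : Formula n} → QuantifierFree φ → Universal φ
  all    : ∀ {n} {φ : Formula (suc n)} → Universal φ → Universal (∀' φ)

-- For 𝔑₀, whose atomic formulas are decidable, the constructive reading of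
-- M ⊨ φ for universal φ coincides with classical truth.
Th∀ : Structure → Theory
Th∀ M φ = Universal φ × (M ⊨ φ)

𝟚 𝟛 : ∀ {n} → Term n
𝟚 = 𝟙 ⊕ 𝟙
𝟛 = 𝟚 ⊕ 𝟙

_≺_ : ∀ {n} → Term n → Term n → Formula n
s ≺ t = s ≼ t ∧ ~ (s ≈ t)

_∣_ : ∀ {n} → Term n → Term n → Formula n
s ∣ t = ∃' (var zero ∙ wkₜ s ≈ wkₜ t)

pow₂ : ∀ {n} → Term n → Formula n
pow₂ t = ∀' (var zero ∣ wkₜ t ⇒ var zero ≈ 𝟙 ∨ 𝟚 ∣ var zero)

∀* : ∀ n → Formula n → Sentence
∀* zero    φ = φ
∀* (suc n) φ = ∀* n (∀' φ)

private
  x : ∀ {n} → Term (suc n)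
  x = var zero
  y : ∀ {n} → Term (suc (suc n))
  y = var (suc zero)
  z : ∀ {n} → Term (suc (suc (suc n)))
  z = var (suc (suc zero))

-- In the axioms x, y, z are the variables 0, 1, 2 outside any inner
-- quantifier; below an inner ∃' they are weakened and var zero is the
-- variable it binds.
data PA⁻smu : Theory where
  pa1  : PA⁻smu (∀* 1 (x ⊕ 𝟘 ≈ x))
  pa2  : PA⁻smu (∀* 2 (x ⊕ y ≈ y ⊕ x))
  pa3  : PA⁻smu (∀* 3 ((x ⊕ y) ⊕ z ≈ x ⊕ (y ⊕ z)))
  pa4  : PA⁻smu (∀* 1 (x ∙ 𝟙 ≈ x))
  pa5  : PA⁻smu (∀* 2 (x ∙ y ≈ y ∙ x))
  pa6  : PA⁻smu (∀* 3 ((x ∙ y) ∙ z ≈ x ∙ (y ∙ z)))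
  pa7  : PA⁻smu (∀* 3 (x ∙ (y ⊕ z) ≈ x ∙ y ⊕ x ∙ z))
  pa8  : PA⁻smu (∀* 2 (x ≼ y ∨ y ≼ x))
  pa9  : PA⁻smu (∀* 3 (x ≼ y ∧ y ≼ z ⇒ x ≼ z))
  pa10 : PA⁻smu (∀* 1 (~ (x ⊕ 𝟙 ≼ x)))
  pa11 : PA⁻smu (∀* 2 (y ≼ x ⇒ y ≈ x ∨ y ⊕ 𝟙 ≼ x))
  pa12 : PA⁻smu (∀* 3 (y ≼ x ⇒ y ⊕ z ≼ x ⊕ z))
  pa13 : PA⁻smu (∀* 3 (y ≼ x ⇒ y ∙ z ≼ x ∙ z))
  pa15 : PA⁻smu (∀* 2 (y ≼ x ⇒ ∃' (wkₜ x ≈ wkₜ y ⊕ var zero)))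
  pa19 : PA⁻smu (∀* 1 (∃' (pow₂ (var zero) ∧ var zero ≼ wkₜ x ⊕ 𝟙
                                          ∧ wkₜ x ⊕ 𝟙 ≺ 𝟚 ∙ var zero)))
  pa20 : PA⁻smu (∀* 2 (pow₂ x ∧ pow₂ y ∧ x ≼ y ⇒ x ∣ y))

numeral : ∀ {m} → ℕ → Term m
numeral 0             = 𝟘
numeral 1             = 𝟙
numeral (suc (suc n)) = numeral (suc n) ⊕ 𝟙

-- ∀x ∃q ∃r: under the three binders x, q, r are the variables 2, 1, 0.
euclid : Term 3 → Sentence
euclid d = ∀' (∃' (∃' (r ≺ d ∧ x' ≈ q ∙ d ⊕ r)))
  where
  r q x' : Term 3
  r  = var zero
  q  = var (suc zero)
  x' = var (suc (suc zero))

pa16 : ℕ → Sentence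
pa16 n = euclid (numeral n)

pa16₃ : Sentence
pa16₃ = euclid 𝟛

pa16₃-instance : pa16 3 ≡ pa16₃
pa16₃-instance = refl

_⊢pa16 : Theory → Set
T ⊢pa16 = ∀ n → .{{_ : NonZero n}} → T ⊢ pa16 n

{-# OPTIONS --safe #-}
-- The countermodel consists of germs at infinity of functions k ↦ p(2^k) into ℕ, where p is a
-- polynomial with dyadic coefficients and integral constant term.
--  * Equality and order of two germs are eventually decided by the leading coefficient of a
--    difference, so quantifier-free truth in the model is eventual pointwise truth in ℕ, and true
--    universal sentences transfer.
--  * Pulling out the 2-adic part of the lowest non-zero coefficient writes every non-zero germ as a
--    power of two times an odd germ; hence pow₂ holds exactly of the germs 2^(c + i k). These
--    divide each other when ordered, and the leading term locates one in [x / 2 , x].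
--  * A germ below 3 is constant, whereas the remainder of 2^k modulo 3 alternates.
module Submission where

open import Data.Empty using (⊥)
open import Data.Fin using (zero; suc)
open import Data.Integer using (ℤ; +_; -[1+_]; 0ℤ; 1ℤ; ∣_∣; sign; _◃_; +≤+; -≤+)
  renaming (_+_ to _+ᶻ_; _*_ to _*ᶻ_; -_ to -ᶻ_; _≤_ to _≤ᶻ_)
import Data.Integer.Divisibility.Signed as ℤ∣
import Data.Integer.Properties as ℤ
open import Data.Integer.Tactic.RingSolver using (solve-∀)
open import Data.List using (List; []; _∷_; map)
open import Data.List.Relation.Unary.All as All using (All; []; _∷_)
import Data.List.Relation.Unary.All.Properties as All
open import Data.Nat using (ℕ; zero; suc; _+_; _*_; _∸_; _^_; _⊔_; _≤_; _≰_; _<_; z≤n; s≤s; >-nonZero)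
open import Data.Nat.Coprimality using (coprime-divisor)
open import Data.Nat.Divisibility
  using (divides; _∣?_; n∣m*n; ∣1⇒≡1; ∣m+n∣m⇒∣n; ∣m∣n⇒∣m+n)
open import Data.Nat.Induction using (<-rec)
open import Data.Nat.Primality using (prime⇒irreducible; prime[2])
import Data.Nat.Properties as ℕ
import Data.Nat.Tactic.RingSolver as ℕ-Solver
open import Data.Product as Product using (Σ; ∃; _×_; _,_; proj₁; proj₂)
import Data.Sign as Sign
open import Data.Sum as Sum using (_⊎_; inj₁; inj₂; [_,_]′)
open import Data.Vec.Functional as Vector using (Vector)
open import Function using (_∘_; id; _⇔_; mk⇔; Equivalence)
open import Relation.Binary using (IsEquivalence)
open import Relation.Binary.PropositionalEquality as ≡
  using (_≡_; _≢_; refl; sym; trans; cong; cong₂; module ≡-Reasoning)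
open import Relation.Nullary using (¬_; Stable; yes; no; contradiction; negated-stable)
open import Relation.Nullary.Decidable using (toWitnessFalse)
open import Relation.Nullary.Negation using (¬¬-map)
open import Relation.Unary using (_∪_)
open import Defs hiding (_∣_)

-- Soundness for a negative-translation semantics

-- Germs are compared by a congruence `≐` because no quotient is formed. Stability of the two atomic
-- relations is the base case of stability for all formulas.
record StableStructure : Set₁ where
  infixl 6 _⊞_
  infixl 7 _⊠_
  infix  4 _≐_ _⊑_
  field
    Carrier       : Set
    0# 1#         : Carrier
    _⊞_ _⊠_       : Carrier → Carrier → Carrier
    _≐_ _⊑_       : Carrier → Carrier → Set
    isEquivalence : IsEquivalence _≐_
    ⊞-cong        : ∀ {a b c d} → a ≐ b → c ≐ d → a ⊞ c ≐ b ⊞ d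
    ⊠-cong        : ∀ {a b c d} → a ≐ b → c ≐ d → a ⊠ c ≐ b ⊠ d
    ⊑-resp-≐      : ∀ {a b c d} → a ≐ b → c ≐ d → a ⊑ c → b ⊑ d
    ≐-stable      : ∀ {a b} → Stable (a ≐ b)
    ⊑-stable      : ∀ {a b} → Stable (a ⊑ b)

  open IsEquivalence isEquivalence public
    renaming (refl to ≐-refl; sym to ≐-sym; trans to ≐-trans)

-- Disjunction and existence are read under a double negation, which makes
-- classical deduction sound without excluded middle in the metatheory.
module NegativeSemantics (M : StableStructure) where
  open StableStructure M

  Env : ℕ → Set
  Env = Vector Carrier

  ⟦_⟧ₜ : ∀ {n} → Term n → Env n → Carrier
  ⟦ var i ⟧ₜ ρ = ρ i
  ⟦ 𝟘 ⟧ₜ     ρ = 0#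
  ⟦ 𝟙 ⟧ₜ     ρ = 1#
  ⟦ s ⊕ t ⟧ₜ ρ = ⟦ s ⟧ₜ ρ ⊞ ⟦ t ⟧ₜ ρ
  ⟦ s ∙ t ⟧ₜ ρ = ⟦ s ⟧ₜ ρ ⊠ ⟦ t ⟧ₜ ρ

  ⟦_⟧ : ∀ {n} → Formula n → Env n → Set
  ⟦ s ≈ t ⟧ ρ = ⟦ s ⟧ₜ ρ ≐ ⟦ t ⟧ₜ ρ
  ⟦ s ≼ t ⟧ ρ = ⟦ s ⟧ₜ ρ ⊑ ⟦ t ⟧ₜ ρ
  ⟦ ⊥' ⟧    ρ = ⊥
  ⟦ φ ∧ ψ ⟧ ρ = ⟦ φ ⟧ ρ × ⟦ ψ ⟧ ρ
  ⟦ φ ∨ ψ ⟧ ρ = ¬ ¬ (⟦ φ ⟧ ρ ⊎ ⟦ ψ ⟧ ρ)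
  ⟦ φ ⇒ ψ ⟧ ρ = ⟦ φ ⟧ ρ → ⟦ ψ ⟧ ρ
  ⟦ ∀' φ ⟧  ρ = ∀ a → ⟦ φ ⟧ (a Vector.∷ ρ)
  ⟦ ∃' φ ⟧  ρ = ¬ ¬ Σ Carrier λ a → ⟦ φ ⟧ (a Vector.∷ ρ)

  -- Needed by `raa`, and by `∨-E` and `∃-E` to leave the double negation of their major premise.
  ⟦⟧-stable : ∀ {n} (φ : Formula n) {ρ} → Stable (⟦ φ ⟧ ρ)
  ⟦⟧-stable (s ≈ t) = ≐-stable
  ⟦⟧-stable (s ≼ t) = ⊑-stable
  ⟦⟧-stable ⊥'      = λ ¬¬⊥ → ¬¬⊥ id
  ⟦⟧-stable (φ ∧ ψ) = λ p → ⟦⟧-stable φ (¬¬-map proj₁ p) , ⟦⟧-stable ψ (¬¬-map proj₂ p)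
  ⟦⟧-stable (φ ∨ ψ) = negated-stable
  ⟦⟧-stable (φ ⇒ ψ) = λ p a → ⟦⟧-stable ψ (¬¬-map (λ f → f a) p)
  ⟦⟧-stable (∀' φ)  = λ p a → ⟦⟧-stable φ (¬¬-map (λ f → f a) p)
  ⟦⟧-stable (∃' φ)  = negated-stable

  -- Agreement is pointwise and up to `≐`, so no function extensionality is involved.
  record Interprets {m n} (σ : Subst m n) (ρ : Env n) (ρ′ : Env m) : Set where
    constructor interprets
    field apply : ∀ i → ⟦ σ i ⟧ₜ ρ ≐ ρ′ i

  ⟦substₜ⟧ : ∀ {m n} (t : Term m) {σ : Subst m n} {ρ ρ′} →
             Interprets σ ρ ρ′ → ⟦ substₜ σ t ⟧ₜ ρ ≐ ⟦ t ⟧ₜ ρ′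
  ⟦substₜ⟧ (var i) σ≐ = Interprets.apply σ≐ i
  ⟦substₜ⟧ 𝟘       σ≐ = ≐-refl
  ⟦substₜ⟧ 𝟙       σ≐ = ≐-refl
  ⟦substₜ⟧ (s ⊕ t) σ≐ = ⊞-cong (⟦substₜ⟧ s σ≐) (⟦substₜ⟧ t σ≐)
  ⟦substₜ⟧ (s ∙ t) σ≐ = ⊠-cong (⟦substₜ⟧ s σ≐) (⟦substₜ⟧ t σ≐)

  lift-interprets : ∀ {m n} {σ : Subst m n} {ρ ρ′} → Interprets σ ρ ρ′ →
                    ∀ a → Interprets (lift σ) (a Vector.∷ ρ) (a Vector.∷ ρ′)
  lift-interprets {σ = σ} (interprets σ≐) a = interprets λ
    { zero    → ≐-refl
    ; (suc i) → ≐-trans (⟦substₜ⟧ (σ i) (interprets λ _ → ≐-refl)) (σ≐ i)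
    }

  ⟦subst⟧ : ∀ {m n} (φ : Formula m) {σ : Subst m n} {ρ ρ′} →
            Interprets σ ρ ρ′ → ⟦ subst σ φ ⟧ ρ ⇔ ⟦ φ ⟧ ρ′
  ⟦subst⟧ (s ≈ t) σ≐ = mk⇔
    (λ p → ≐-trans (≐-sym (⟦substₜ⟧ s σ≐)) (≐-trans p (⟦substₜ⟧ t σ≐)))
    (λ p → ≐-trans (⟦substₜ⟧ s σ≐) (≐-trans p (≐-sym (⟦substₜ⟧ t σ≐))))
  ⟦subst⟧ (s ≼ t) σ≐ = mk⇔
    (⊑-resp-≐ (⟦substₜ⟧ s σ≐) (⟦substₜ⟧ t σ≐))
    (⊑-resp-≐ (≐-sym (⟦substₜ⟧ s σ≐)) (≐-sym (⟦substₜ⟧ t σ≐)))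
  ⟦subst⟧ ⊥'      σ≐ = mk⇔ id id
  ⟦subst⟧ (φ ∧ ψ) σ≐ = mk⇔ (Product.map φ.to ψ.to) (Product.map φ.from ψ.from)
    where module φ = Equivalence (⟦subst⟧ φ σ≐)
          module ψ = Equivalence (⟦subst⟧ ψ σ≐)
  ⟦subst⟧ (φ ∨ ψ) σ≐ = mk⇔ (¬¬-map (Sum.map φ.to ψ.to)) (¬¬-map (Sum.map φ.from ψ.from))
    where module φ = Equivalence (⟦subst⟧ φ σ≐)
          module ψ = Equivalence (⟦subst⟧ ψ σ≐)
  ⟦subst⟧ (φ ⇒ ψ) σ≐ = mk⇔ (λ f → ψ.to ∘ f ∘ φ.from) (λ f → ψ.from ∘ f ∘ φ.to)
    where module φ = Equivalence (⟦subst⟧ φ σ≐)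
          module ψ = Equivalence (⟦subst⟧ ψ σ≐)
  ⟦subst⟧ (∀' φ)  σ≐ = mk⇔ (λ f a → φ.to a (f a)) (λ f a → φ.from a (f a))
    where module φ a = Equivalence (⟦subst⟧ φ (lift-interprets σ≐ a))
  ⟦subst⟧ (∃' φ)  σ≐ = mk⇔ (¬¬-map λ (a , p) → a , φ.to a p) (¬¬-map λ (a , p) → a , φ.from a p)
    where module φ a = Equivalence (⟦subst⟧ φ (lift-interprets σ≐ a))

  -- The value `a` need only be `≐` to that of `t`: `≈-subst` thereby compares both of its instances
  -- with one and the same environment.
  ⟦[]⟧ : ∀ {n} (φ : Formula (suc n)) {t ρ a} → ⟦ t ⟧ₜ ρ ≐ a →
         ⟦ φ [ t ] ⟧ ρ ⇔ ⟦ φ ⟧ (a Vector.∷ ρ)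
  ⟦[]⟧ φ t≐a = ⟦subst⟧ φ (interprets λ { zero → t≐a ; (suc i) → ≐-refl })

  ⟦wk⟧ : ∀ {n} (φ : Formula n) {ρ a} → ⟦ wk φ ⟧ (a Vector.∷ ρ) ⇔ ⟦ φ ⟧ ρ
  ⟦wk⟧ φ = ⟦subst⟧ φ (interprets λ _ → ≐-refl)

  Holds : ∀ {n} → List (Formula n) → Env n → Set
  Holds Γ ρ = All (λ φ → ⟦ φ ⟧ ρ) Γ

  wk-Holds : ∀ {n} {Γ : List (Formula n)} {ρ} a → Holds Γ ρ → Holds (map wk Γ) (a Vector.∷ ρ)
  wk-Holds a γ = All.map⁺ (All.map (λ {φ} → Equivalence.from (⟦wk⟧ φ)) γ)

  soundness : ∀ {T : Theory} → (∀ {φ} → T φ → ⟦ φ ⟧ Vector.[]) →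
              ∀ {n} {Γ : List (Formula n)} {φ} → T ∣ Γ ⊢ φ → ∀ {ρ} → Holds Γ ρ → ⟦ φ ⟧ ρ
  soundness {T} model = sound
    where
    sound : ∀ {n} {Γ : List (Formula n)} {φ} → T ∣ Γ ⊢ φ → ∀ {ρ} → Holds Γ ρ → ⟦ φ ⟧ ρ
    sound (axiom {φ} p)     γ = Equivalence.from (⟦subst⟧ φ (interprets λ ())) (model p)
    sound (assume i)        γ = All.lookup γ i
    sound (⇒-I d)           γ = λ p → sound d (p ∷ γ)
    sound (⇒-E d e)         γ = sound d γ (sound e γ)
    sound (∧-I d e)         γ = sound d γ , sound e γ
    sound (∧-E₁ d)          γ = proj₁ (sound d γ)
    sound (∧-E₂ d)          γ = proj₂ (sound d γ)
    -- `contradiction p`, awaiting a refutation of `p`, serves as double negation introduction here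
    -- and below.
    sound (∨-I₁ d)          γ = contradiction (inj₁ (sound d γ))
    sound (∨-I₂ d)          γ = contradiction (inj₂ (sound d γ))
    sound {φ = χ} (∨-E d e f) γ =
      ⟦⟧-stable χ (¬¬-map [ (λ p → sound e (p ∷ γ)) , (λ p → sound f (p ∷ γ)) ]′ (sound d γ))
    sound {φ = φ} (raa d)   γ = ⟦⟧-stable φ λ ¬p → sound d (¬p ∷ γ)
    sound (∀-I d)           γ = λ a → sound d (wk-Holds a γ)
    sound (∀-E {φ} d t)     γ = Equivalence.from (⟦[]⟧ φ ≐-refl) (sound d γ _)
    sound (∃-I {φ} t d)     γ = contradiction (_ , Equivalence.to (⟦[]⟧ φ ≐-refl) (sound d γ))
    sound {φ = ψ} (∃-E d e) γ = ⟦⟧-stable ψ (¬¬-map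
      (λ (a , p) → Equivalence.to (⟦wk⟧ ψ) (sound e (p ∷ wk-Holds a γ))) (sound d γ))
    sound ≈-refl            γ = ≐-refl
    sound (≈-subst φ d e)   γ =
      Equivalence.from (⟦[]⟧ φ (≐-sym (sound d γ))) (Equivalence.to (⟦[]⟧ φ ≐-refl) (sound e γ))

-- Eventual properties and polynomials in powers of two

open import Data.Nat.Divisibility using (_∣_)

record Eventually (P : ℕ → Set) : Set where
  constructor since
  field
    start : ℕ
    holds : ∀ k → start ≤ k → P k

module _ {P : ℕ → Set} where
  always : (∀ k → P k) → Eventually P
  always p = since 0 λ k _ → p k

  witness : Eventually P → ∃ P
  witness (since m p) = m , p m ℕ.≤-refl

  eventually-map : ∀ {Q : ℕ → Set} → (∀ {k} → P k → Q k) → Eventually P → Eventually Q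
  eventually-map f (since m p) = since m λ k m≤k → f (p k m≤k)

  eventually-zip : ∀ {Q R : ℕ → Set} → (∀ {k} → P k → Q k → R k) →
                   Eventually P → Eventually Q → Eventually R
  eventually-zip f (since m p) (since n q) = since (m ⊔ n) λ k m⊔n≤k →
    f (p k (ℕ.≤-trans (ℕ.m≤m⊔n m n) m⊔n≤k)) (q k (ℕ.≤-trans (ℕ.m≤n⊔m m n) m⊔n≤k))

infixl 1 _&_
_&_ : ∀ {P Q : ℕ → Set} → Eventually P → Eventually Q → Eventually (λ k → P k × Q k)
_&_ = eventually-zip _,_

≥-eventually : ∀ m → Eventually (m ≤_)
≥-eventually m = since m λ _ m≤k → m≤k

2^ : ℕ → ℤ
2^ n = + (2 ^ n)

2^-+ : ∀ m n → 2^ (m + n) ≡ 2^ m *ᶻ 2^ n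
2^-+ m n = trans (cong +_ (ℕ.^-distribˡ-+-* 2 m n)) (ℤ.pos-* (2 ^ m) (2 ^ n))

n<2^n : ∀ n → n < 2 ^ n
n<2^n zero    = s≤s z≤n
n<2^n (suc n) = ℕ.≤-trans (ℕ.+-mono-≤ (ℕ.m^n>0 2 n) (n<2^n n))
                          (ℕ.+-monoʳ-≤ (2 ^ n) (ℕ.m≤m+n (2 ^ n) 0))

∸-split : ∀ {m n k} → m ≤ n → n ≤ k → k ∸ m ≡ (k ∸ n) + (n ∸ m)
∸-split {m} {n} {k} m≤n n≤k = begin
  k ∸ m                ≡⟨ cong (_∸ m) (ℕ.m∸n+n≡m n≤k) ⟨
  (k ∸ n) + n ∸ m      ≡⟨ ℕ.+-∸-assoc (k ∸ n) m≤n ⟩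
  (k ∸ n) + (n ∸ m)    ∎
  where open ≡-Reasoning

-- The sequences that are eventually integral polynomials in 2^(k∸e), for large k thus polynomials
-- in 2^k whose coefficients are dyadic and whose constant term is integral.
data Poly (e : ℕ) (g : ℕ → ℤ) : Set where
  zero   : Eventually (λ k → g k ≡ 0ℤ) → Poly e g
  horner : ∀ a {h} → Poly e h → Eventually (λ k → g k ≡ a +ᶻ 2^ (k ∸ e) *ᶻ h k) → Poly e g

module _ {e : ℕ} where
  poly-resp : ∀ {f g} → Eventually (λ k → f k ≡ g k) → Poly e f → Poly e g
  poly-resp f≡g (zero z)       = zero (eventually-zip (λ p q → trans (sym p) q) f≡g z)
  poly-resp f≡g (horner a p s) = horner a p (eventually-zip (λ p q → trans (sym p) q) f≡g s)

  poly-shift : ∀ {h} → Poly e h → Poly e (λ k → 2^ (k ∸ e) *ᶻ h k)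
  poly-shift p = horner 0ℤ p (always λ _ → sym (ℤ.+-identityˡ _))

  poly-const : ∀ a → Poly e (λ _ → a)
  poly-const a = horner a (zero (always λ _ → refl))
    (always λ k → sym (trans (cong (a +ᶻ_) (ℤ.*-zeroʳ (2^ (k ∸ e)))) (ℤ.+-identityʳ a)))

  poly-scale : ∀ {g} c → Poly e g → Poly e (λ k → c *ᶻ g k)
  poly-scale c (zero z)       = zero (eventually-map (λ p → trans (cong (c *ᶻ_) p) (ℤ.*-zeroʳ c)) z)
  poly-scale c (horner a {h} p s) = horner (c *ᶻ a) (poly-scale c p)
    (eventually-map (λ {k} p → trans (cong (c *ᶻ_) p) (expand c a (2^ (k ∸ e)) (h k))) s)
    where
    expand : ∀ c a t h → c *ᶻ (a +ᶻ t *ᶻ h) ≡ c *ᶻ a +ᶻ t *ᶻ (c *ᶻ h)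
    expand = solve-∀

  poly-+ : ∀ {f g} → Poly e f → Poly e g → Poly e (λ k → f k +ᶻ g k)
  poly-+ (zero z) q =
    poly-resp (eventually-map (λ p → sym (trans (cong (_+ᶻ _) p) (ℤ.+-identityˡ _))) z) q
  poly-+ (horner a p s) (zero z) =
    horner a p (eventually-zip (λ p q → trans (cong₂ _+ᶻ_ p q) (ℤ.+-identityʳ _)) s z)
  poly-+ (horner a {h} p s) (horner b {h′} q t) = horner (a +ᶻ b) (poly-+ p q)
    (eventually-zip (λ {k} p q → trans (cong₂ _+ᶻ_ p q) (expand a b (2^ (k ∸ e)) (h k) (h′ k))) s t)
    where
    expand : ∀ a b t h h′ → a +ᶻ t *ᶻ h +ᶻ (b +ᶻ t *ᶻ h′) ≡ a +ᶻ b +ᶻ t *ᶻ (h +ᶻ h′)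
    expand = solve-∀

  poly-* : ∀ {f g} → Poly e f → Poly e g → Poly e (λ k → f k *ᶻ g k)
  poly-* {g = g} (zero z) q =
    zero (eventually-map (λ {k} p → trans (cong (_*ᶻ g k) p) (ℤ.*-zeroˡ (g k))) z)
  poly-* {g = g} (horner a {h} p s) q = poly-resp
    (eventually-map (λ {k} p → sym (trans (cong (_*ᶻ g k) p) (expand a (2^ (k ∸ e)) (h k) (g k)))) s)
    (poly-+ (poly-scale a q) (poly-shift (poly-* p q)))
    where
    expand : ∀ a t h g → (a +ᶻ t *ᶻ h) *ᶻ g ≡ a *ᶻ g +ᶻ t *ᶻ (h *ᶻ g)
    expand = solve-∀

-- For `k ≥ e′` the factor `2^(k∸e)` is `2^(k∸e′)` times the constant `2^(e′∸e)`, which the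
-- remaining coefficients absorb.
poly-raise : ∀ {e e′ g} → e ≤ e′ → Poly e g → Poly e′ g
poly-raise e≤e′ (zero z) = zero z
poly-raise {e} {e′} e≤e′ (horner a p s) = horner a (poly-scale (2^ (e′ ∸ e)) (poly-raise e≤e′ p))
  (eventually-zip (λ p q → trans p (cong (a +ᶻ_) (split q _))) s (≥-eventually e′))
  where
  split : ∀ {k} → e′ ≤ k → ∀ h → 2^ (k ∸ e) *ᶻ h ≡ 2^ (k ∸ e′) *ᶻ (2^ (e′ ∸ e) *ᶻ h)
  split {k} e′≤k h = trans
    (cong (_*ᶻ h) (trans (cong 2^ (∸-split e≤e′ e′≤k)) (2^-+ (k ∸ e′) (e′ ∸ e))))
    (ℤ.*-assoc (2^ (k ∸ e′)) (2^ (e′ ∸ e)) h)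

-- Poly e is monotone in e, so two regular sequences have a common e.
Regular : (ℕ → ℤ) → Set
Regular g = Eventually λ e → Poly e g

regular : ∀ {e g} → Poly e g → Regular g
regular {e} p = since e λ _ e≤e′ → poly-raise e≤e′ p

regular-resp : ∀ {f g} → Eventually (λ k → f k ≡ g k) → Regular f → Regular g
regular-resp f≡g = eventually-map (poly-resp f≡g)

regular-const : ∀ a → Regular (λ _ → a)
regular-const a = always λ _ → poly-const a

regular-+ : ∀ {f g} → Regular f → Regular g → Regular (λ k → f k +ᶻ g k)
regular-+ = eventually-zip poly-+

regular-* : ∀ {f g} → Regular f → Regular g → Regular (λ k → f k *ᶻ g k)
regular-* = eventually-zip poly-*

regular-neg : ∀ {g} → Regular g → Regular (λ k → -ᶻ g k)
regular-neg r = regular-resp (always λ k → ℤ.-1*i≡-i _) (regular-* (regular-const (-[1+ 0 ])) r)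

regular-2^∸ : ∀ e → Regular (λ k → 2^ (k ∸ e))
regular-2^∸ e = regular-resp (always λ k → ℤ.*-identityʳ _) (regular {e} (poly-shift (poly-const 1ℤ)))

-- The exponent is q - p + slope * k.
record Monomial (u : ℕ → ℕ) : Set where
  constructor monomial
  field
    exponent      : ℕ → ℕ
    p q slope     : ℕ
    power         : Eventually (λ k → u k ≡ 2 ^ exponent k)
    affine        : Eventually (λ k → exponent k + p ≡ q + slope * k)

monomial-2^∸ : ∀ e → Monomial (λ k → 2 ^ (k ∸ e))
monomial-2^∸ e = monomial (_∸ e) e 0 1 (always λ _ → refl)
  (eventually-map (λ e≤k → trans (ℕ.m∸n+n≡m e≤k) (sym (ℕ.+-identityʳ _))) (≥-eventually e))

monomial-2^ : ∀ c → Monomial (λ _ → 2 ^ c)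
monomial-2^ c = monomial (λ _ → c) 0 c 0 (always λ _ → refl) (always λ _ → refl)

monomial-* : ∀ {u v} → Monomial u → Monomial v → Monomial (λ k → u k * v k)
monomial-* (monomial a p q i u≡ a≡) (monomial b p′ q′ i′ v≡ b≡) =
  monomial (λ k → a k + b k) (p + p′) (q + q′) (i + i′)
    (eventually-zip (λ {k} u≡ v≡ → trans (cong₂ _*_ u≡ v≡) (sym (ℕ.^-distribˡ-+-* 2 (a k) (b k)))) u≡ v≡)
    (eventually-zip (λ {k} a≡ b≡ →
      trans (swap (a k) (b k) p p′) (trans (cong₂ _+_ a≡ b≡) (collect q q′ i i′ k))) a≡ b≡)
  where
  swap : ∀ a b p p′ → a + b + (p + p′) ≡ (a + p) + (b + p′)
  swap = ℕ-Solver.solve-∀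
  collect : ∀ q q′ i i′ k → (q + i * k) + (q′ + i′ * k) ≡ q + q′ + (i + i′) * k
  collect = ℕ-Solver.solve-∀

monomial-positive : ∀ {u} → Monomial u → Eventually (λ k → 1 ≤ u k)
monomial-positive m = eventually-map (λ {k} u≡ → ℕ.≤-trans (ℕ.m^n>0 2 (exponent k)) (ℕ.≤-reflexive (sym u≡))) power
  where open Monomial m

-- With positive slope, one factor `2^k` absorbs the offset `p`, since `2^(k∸p)` is regular. With
-- slope zero the exponent is eventually a constant natural number, so `q ∸ p` does not truncate.
monomial-regular : ∀ {u} → Monomial u → Regular (λ k → + u k)
monomial-regular (monomial a p q zero u≡ a≡) = regular-resp
  (eventually-zip (λ u≡ a≡ → cong +_ (sym (trans u≡ (cong (2 ^_) (solved a≡))))) u≡ a≡)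
  (regular-const (2^ (q ∸ p)))
  where
  solved : ∀ {a} → a + p ≡ q + 0 → a ≡ q ∸ p
  solved {a} a≡ = trans (sym (ℕ.m+n∸n≡m a p)) (cong (_∸ p) (trans a≡ (ℕ.+-identityʳ q)))
monomial-regular {u} (monomial a p q (suc i) u≡ a≡) = regular-resp
  (eventually-zip (λ {k} (u≡ , a≡) p≤k → sym (trans (cong +_ u≡)
    (trans (cong 2^ (solved k p≤k a≡)) (2^-+ (k ∸ p) (q + i * k))))) (u≡ & a≡) (≥-eventually p))
  (regular-* (regular-2^∸ p) (regular-2^-linear i))
  where
  regular-2^-linear : ∀ i → Regular (λ k → 2^ (q + i * k))
  regular-2^-linear zero    = regular-const (2^ (q + 0))
  regular-2^-linear (suc i) = regular-resp
    (always λ k → trans (sym (2^-+ k (q + i * k))) (cong 2^ (swap q k (i * k))))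
    (regular-* (regular-2^∸ 0) (regular-2^-linear i))
    where
    swap : ∀ q k l → k + (q + l) ≡ q + (k + l)
    swap = ℕ-Solver.solve-∀

  solved : ∀ k → p ≤ k → a k + p ≡ q + suc i * k → a k ≡ (k ∸ p) + (q + i * k)
  solved k p≤k a≡ = ℕ.+-cancelʳ-≡ p _ _ (begin
    a k + p                      ≡⟨ a≡ ⟩
    q + suc i * k                ≡⟨ swap q k (i * k) ⟩
    k + (q + i * k)              ≡⟨ cong (_+ (q + i * k)) (ℕ.m∸n+n≡m p≤k) ⟨
    (k ∸ p) + p + (q + i * k)    ≡⟨ swap′ (k ∸ p) p (q + i * k) ⟩
    (k ∸ p) + (q + i * k) + p    ∎)
    where
    open ≡-Reasoning
    swap : ∀ q k l → q + (k + l) ≡ k + (q + l)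
    swap = ℕ-Solver.solve-∀
    swap′ : ∀ d p l → d + p + l ≡ d + l + p
    swap′ = ℕ-Solver.solve-∀

-- Growth and eventual signs

-- Eventual positivity with the order of magnitude: a power of two up to a bounded factor. The lower
-- bound decides comparisons, the upper bound limits the search in `leading-power`.
record Growth (g : ℕ → ℤ) : Set where
  constructor growth
  field
    {scale}  : ℕ → ℕ
    ratio    : ℕ
    monomial-scale : Monomial scale
    bounds   : Eventually (λ k → + scale k ≤ᶻ g k × g k ≤ᶻ + ratio *ᶻ + scale k)

growth-resp : ∀ {f g} → Eventually (λ k → f k ≡ g k) → Growth f → Growth g
growth-resp f≡g (growth {u} B m b) = growth B m (eventually-zip
  (λ {k} p → ≡.subst (λ i → + u k ≤ᶻ i × i ≤ᶻ + B *ᶻ + u k) p) f≡g b)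

i≤∣i∣ : ∀ i → i ≤ᶻ + ∣ i ∣
i≤∣i∣ (+ n)    = ℤ.≤-refl
i≤∣i∣ -[1+ n ] = -≤+

-- With 2S = 2^(k∸e), large k give |a| ≤ S ≤ S h, so a + 2S h lies between S h and 3S h.
growth-horner : ∀ e a {h} → Growth h → Growth (λ k → a +ᶻ 2^ (k ∸ e) *ᶻ h k)
growth-horner e a {h} (growth {u} B m b) = growth (3 * B) (monomial-* (monomial-2^∸ (suc e)) m)
  (eventually-zip (λ { {k} (((l , r) , 1≤u) , e<k) ∣a∣+≤k → step k l r 1≤u e<k (large k ∣a∣+≤k) })
    (b & monomial-positive m & ≥-eventually (suc e)) (≥-eventually (∣ a ∣ + suc e)))
  where
  large : ∀ k → ∣ a ∣ + suc e ≤ k → ∣ a ∣ ≤ 2 ^ (k ∸ suc e)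
  large k p = ℕ.≤-trans (ℕ.m+n≤o⇒m≤o∸n ∣ a ∣ p) (ℕ.<⇒≤ (n<2^n (k ∸ suc e)))

  step : ∀ k → + u k ≤ᶻ h k → h k ≤ᶻ + B *ᶻ + u k → 1 ≤ u k → suc e ≤ k → ∣ a ∣ ≤ 2 ^ (k ∸ suc e) →
         + (2 ^ (k ∸ suc e) * u k) ≤ᶻ a +ᶻ 2^ (k ∸ e) *ᶻ h k
         × a +ᶻ 2^ (k ∸ e) *ᶻ h k ≤ᶻ + (3 * B) *ᶻ + (2 ^ (k ∸ suc e) * u k)
  step k l r 1≤u e<k ∣a∣≤S = lower , upper
    where
    open ℤ.≤-Reasoning
    S H U : ℤ
    S = 2^ (k ∸ suc e)
    H = h k
    U = + u k
    double : 2^ (k ∸ e) ≡ + 2 *ᶻ S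
    double = trans (cong 2^ (ℕ.+-∸-assoc 1 e<k)) (2^-+ 1 (k ∸ suc e))
    S≤SH : S ≤ᶻ S *ᶻ H
    S≤SH = begin
      S          ≡⟨ ℤ.*-identityʳ S ⟨
      S *ᶻ 1ℤ    ≤⟨ ℤ.*-monoˡ-≤-nonNeg S (ℤ.≤-trans (+≤+ 1≤u) l) ⟩
      S *ᶻ H     ∎
    lower = begin
      + (2 ^ (k ∸ suc e) * u k)                ≡⟨ ℤ.pos-* (2 ^ (k ∸ suc e)) (u k) ⟩
      S *ᶻ U                                   ≤⟨ ℤ.*-monoˡ-≤-nonNeg S l ⟩
      S *ᶻ H                                   ≡⟨ expand S H ⟩
      -ᶻ (S *ᶻ H) +ᶻ + 2 *ᶻ S *ᶻ H             ≤⟨ ℤ.+-monoˡ-≤ (+ 2 *ᶻ S *ᶻ H) (ℤ.neg-mono-≤ S≤SH) ⟩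
      -ᶻ S +ᶻ + 2 *ᶻ S *ᶻ H                    ≤⟨ ℤ.+-monoˡ-≤ (+ 2 *ᶻ S *ᶻ H) -S≤a ⟩
      a +ᶻ + 2 *ᶻ S *ᶻ H                       ≡⟨ cong (λ t → a +ᶻ t *ᶻ H) double ⟨
      a +ᶻ 2^ (k ∸ e) *ᶻ H                     ∎
      where
      expand : ∀ S H → S *ᶻ H ≡ -ᶻ (S *ᶻ H) +ᶻ + 2 *ᶻ S *ᶻ H
      expand = solve-∀
      -S≤a : -ᶻ S ≤ᶻ a
      -S≤a = begin
        -ᶻ S        ≤⟨ ℤ.neg-mono-≤ (ℤ.≤-trans (i≤∣i∣ (-ᶻ a)) (ℤ.≤-trans (ℤ.≤-reflexive (cong +_ (ℤ.∣-i∣≡∣i∣ a))) (+≤+ ∣a∣≤S))) ⟩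
        -ᶻ (-ᶻ a)   ≡⟨ ℤ.neg-involutive a ⟩
        a           ∎
    upper = begin
      a +ᶻ 2^ (k ∸ e) *ᶻ H                     ≡⟨ cong (λ t → a +ᶻ t *ᶻ H) double ⟩
      a +ᶻ + 2 *ᶻ S *ᶻ H                       ≤⟨ ℤ.+-monoˡ-≤ (+ 2 *ᶻ S *ᶻ H) (ℤ.≤-trans (i≤∣i∣ a) (ℤ.≤-trans (+≤+ ∣a∣≤S) S≤SH)) ⟩
      S *ᶻ H +ᶻ + 2 *ᶻ S *ᶻ H                  ≡⟨ collect S H ⟩
      (+ 3 *ᶻ S) *ᶻ H                          ≡⟨ cong (_*ᶻ H) (ℤ.pos-* 3 (2 ^ (k ∸ suc e))) ⟨
      + (3 * 2 ^ (k ∸ suc e)) *ᶻ H             ≤⟨ ℤ.*-monoˡ-≤-nonNeg (+ (3 * 2 ^ (k ∸ suc e))) r ⟩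
      + (3 * 2 ^ (k ∸ suc e)) *ᶻ (+ B *ᶻ U)    ≡⟨ cong (_*ᶻ (+ B *ᶻ U)) (ℤ.pos-* 3 (2 ^ (k ∸ suc e))) ⟩
      (+ 3 *ᶻ S) *ᶻ (+ B *ᶻ U)                 ≡⟨ swap S (+ B) U ⟩
      (+ 3 *ᶻ + B) *ᶻ (S *ᶻ U)                 ≡⟨ cong₂ _*ᶻ_ (ℤ.pos-* 3 B) (ℤ.pos-* (2 ^ (k ∸ suc e)) (u k)) ⟨
      + (3 * B) *ᶻ + (2 ^ (k ∸ suc e) * u k)   ∎
      where
      collect : ∀ S H → S *ᶻ H +ᶻ + 2 *ᶻ S *ᶻ H ≡ (+ 3 *ᶻ S) *ᶻ H
      collect = solve-∀
      swap : ∀ S B U → (+ 3 *ᶻ S) *ᶻ (B *ᶻ U) ≡ (+ 3 *ᶻ B) *ᶻ (S *ᶻ U)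
      swap = solve-∀

data EventualSign (g : ℕ → ℤ) : Set where
  vanishes : Eventually (λ k → g k ≡ 0ℤ) → EventualSign g
  positive : Growth g → EventualSign g
  negative : Growth (λ k → -ᶻ g k) → EventualSign g

-- A non-zero constant has scale `2 ^ 0`, with its absolute value as ratio.
sign-const : ∀ a → EventualSign (λ _ → a)
sign-const (+ 0)         = vanishes (always λ _ → refl)
sign-const a@(+ (suc n)) = positive (growth (suc n) (monomial-2^ 0)
  (always λ _ → +≤+ (s≤s z≤n) , ℤ.≤-reflexive (sym (ℤ.*-identityʳ a))))
sign-const -[1+ n ]      = negative (growth (suc n) (monomial-2^ 0)
  (always λ _ → +≤+ (s≤s z≤n) , ℤ.≤-reflexive (sym (ℤ.*-identityʳ (+ suc n)))))

sign-resp : ∀ {f g} → Eventually (λ k → f k ≡ g k) → EventualSign f → EventualSign g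
sign-resp f≡g (vanishes z) = vanishes (eventually-zip (λ p q → trans (sym p) q) f≡g z)
sign-resp f≡g (positive p) = positive (growth-resp f≡g p)
sign-resp f≡g (negative p) = negative (growth-resp (eventually-map (cong -ᶻ_) f≡g) p)

-- If the higher part has a sign, the constant term cannot change it, by `growth-horner`; if the
-- higher part vanishes, the constant term decides.
poly-sign : ∀ {e g} → Poly e g → EventualSign g
poly-sign (zero z) = vanishes z
poly-sign {e} {g} (horner a {h} p s) with poly-sign p
... | vanishes z = sign-resp (eventually-zip (λ {k} s z →
        sym (trans s (trans (cong (λ h → a +ᶻ 2^ (k ∸ e) *ᶻ h) z)
        (trans (cong (a +ᶻ_) (ℤ.*-zeroʳ (2^ (k ∸ e)))) (ℤ.+-identityʳ a))))) s z) (sign-const a)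
... | positive γ = positive (growth-resp (eventually-map sym s) (growth-horner e a γ))
... | negative γ = negative (growth-resp
        (eventually-map (λ {k} s → sym (trans (cong -ᶻ_ s) (expand a (2^ (k ∸ e)) (h k)))) s)
        (growth-horner e (-ᶻ a) γ))
  where
  expand : ∀ a t h → -ᶻ (a +ᶻ t *ᶻ h) ≡ -ᶻ a +ᶻ t *ᶻ (-ᶻ h)
  expand = solve-∀

regular-sign : ∀ {g} → Regular g → EventualSign g
regular-sign r = poly-sign (proj₂ (witness r))

-- Odd parts and absolute values

Odd : ℕ → Set
Odd n = ¬ 2 ∣ n

ℕ-oddPart : ∀ n → n ≢ 0 → ∃ λ c → ∃ λ o → n ≡ 2 ^ c * o × Odd o
ℕ-oddPart = <-rec _ go
  where
  go : ∀ n → (∀ {m} → m < n → m ≢ 0 → ∃ λ c → ∃ λ o → m ≡ 2 ^ c * o × Odd o) →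
       n ≢ 0 → ∃ λ c → ∃ λ o → n ≡ 2 ^ c * o × Odd o
  go n rec n≢0 with 2 ∣? n
  ... | no  odd = 0 , n , sym (ℕ.+-identityʳ n) , odd
  ... | yes (divides zero    n≡) = contradiction n≡ n≢0
  ... | yes (divides q@(suc _) refl) with rec (ℕ.m<m*n q 2 (s≤s (s≤s z≤n))) (λ ())
  ...   | c , o , q≡ , odd = suc c , o , trans (cong (_* 2) q≡) (swap (2 ^ c) o) , odd
    where
    swap : ∀ t o → t * o * 2 ≡ 2 * t * o
    swap = ℕ-Solver.solve-∀

ℤ-oddPart : ∀ a → a ≢ 0ℤ → ∃ λ c → ∃ λ o → a ≡ 2^ c *ᶻ o × Odd ∣ o ∣
ℤ-oddPart a a≢0 with ℕ-oddPart ∣ a ∣ (λ ∣a∣≡0 → a≢0 (ℤ.∣i∣≡0⇒i≡0 ∣a∣≡0))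
... | c , o , ∣a∣≡ , odd = c , sign a ◃ o , a≡ , ≡.subst Odd (sym (ℤ.abs-◃ (sign a) o)) odd
  where
  open ≡-Reasoning
  a≡ : a ≡ 2^ c *ᶻ (sign a ◃ o)
  a≡ = begin
    a                                ≡⟨ ℤ.◃-inverse a ⟨
    sign a ◃ ∣ a ∣                   ≡⟨ cong (sign a ◃_) ∣a∣≡ ⟩
    sign a ◃ (2 ^ c * o)             ≡⟨ ℤ.◃-distrib-* Sign.+ (sign a) (2 ^ c) o ⟩
    (Sign.+ ◃ 2 ^ c) *ᶻ (sign a ◃ o) ≡⟨ cong (_*ᶻ (sign a ◃ o)) (ℤ.+◃n≡+n (2 ^ c)) ⟩
    2^ c *ᶻ (sign a ◃ o)             ∎

odd-+ : ∀ o i → Odd ∣ o ∣ → Odd ∣ o +ᶻ + 2 *ᶻ i ∣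
odd-+ o i odd even = odd (ℤ∣.∣⇒∣ᵤ {+ 2} {o}
  (ℤ∣.∣m+n∣n⇒∣m {m = o} (ℤ∣.∣ᵤ⇒∣ {+ 2} even) (ℤ∣.∣m⇒∣m*n i (ℤ∣.∣-refl {+ 2}))))

record OddPart (g : ℕ → ℤ) : Set where
  constructor oddPart
  field
    {power}        : ℕ → ℕ
    {part}         : ℕ → ℤ
    power-monomial : Monomial power
    part-regular   : Regular part
    part-odd       : Eventually (λ k → Odd ∣ part k ∣)
    factors        : Eventually (λ k → g k ≡ + power k *ᶻ part k)

-- Let `a = 2^c o` with `o` odd. For large `k` the factor `2^(k∸e)` also contains `2^c`, and the
-- cofactor `o + 2^(k∸(c+e)) h` is odd once `k > c + e`, its second summand being even. A zero
-- coefficient passes `2^(k∸e)` on to the monomial, and the recursion continues.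
poly-oddPart : ∀ {e g} → Poly e g → Eventually (λ k → g k ≡ 0ℤ) ⊎ OddPart g
poly-oddPart (zero z) = inj₁ z
poly-oddPart {e} (horner a {h} p s) with a ℤ.≟ 0ℤ
... | no a≢0 with c , o , a≡ , odd ← ℤ-oddPart a a≢0 = inj₂ (oddPart (monomial-2^ c)
    (regular-+ (regular-const o) (regular-* (regular-2^∸ (c + e)) (regular p)))
    (eventually-map (λ {k} c+e<k → ≡.subst (λ i → Odd ∣ o +ᶻ i ∣) (even k c+e<k) (odd-+ o (2^ (k ∸ suc (c + e)) *ᶻ h k) odd))
      (≥-eventually (suc (c + e))))
    (eventually-zip (λ {k} s c+e≤k → trans s (factor k c+e≤k)) s (≥-eventually (c + e))))
  where
  open ≡-Reasoning
  even : ∀ k → c + e < k → + 2 *ᶻ (2^ (k ∸ suc (c + e)) *ᶻ h k) ≡ 2^ (k ∸ (c + e)) *ᶻ h k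
  even k c+e<k = trans (sym (ℤ.*-assoc (+ 2) (2^ (k ∸ suc (c + e))) (h k))) (cong (_*ᶻ h k)
    (trans (sym (2^-+ 1 (k ∸ suc (c + e)))) (cong 2^ (sym (ℕ.+-∸-assoc 1 c+e<k)))))
  factor : ∀ k → c + e ≤ k → a +ᶻ 2^ (k ∸ e) *ᶻ h k ≡ 2^ c *ᶻ (o +ᶻ 2^ (k ∸ (c + e)) *ᶻ h k)
  factor k c+e≤k = begin
    a +ᶻ 2^ (k ∸ e) *ᶻ h k                                ≡⟨ cong₂ (λ a t → a +ᶻ t *ᶻ h k) a≡ split ⟩
    2^ c *ᶻ o +ᶻ (2^ (k ∸ (c + e)) *ᶻ 2^ c) *ᶻ h k         ≡⟨ expand (2^ c) o (2^ (k ∸ (c + e))) (h k) ⟩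
    2^ c *ᶻ (o +ᶻ 2^ (k ∸ (c + e)) *ᶻ h k)                 ∎
    where
    split : 2^ (k ∸ e) ≡ 2^ (k ∸ (c + e)) *ᶻ 2^ c
    split = trans (cong 2^ (trans (∸-split (ℕ.m≤n+m e c) c+e≤k) (cong (λ d → k ∸ (c + e) + d) (ℕ.m+n∸n≡m c e))))
                  (2^-+ (k ∸ (c + e)) c)
    expand : ∀ C o t h → C *ᶻ o +ᶻ (t *ᶻ C) *ᶻ h ≡ C *ᶻ (o +ᶻ t *ᶻ h)
    expand = solve-∀
... | yes refl with poly-oddPart p
...   | inj₁ z = inj₁ (eventually-zip (λ {k} s z → trans s (trans (ℤ.+-identityˡ _)
          (trans (cong (2^ (k ∸ e) *ᶻ_) z) (ℤ.*-zeroʳ (2^ (k ∸ e)))))) s z)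
...   | inj₂ (oddPart {u} {o} m r odd f) = inj₂ (oddPart (monomial-* (monomial-2^∸ e) m) r odd
          (eventually-zip (λ {k} s f → trans s (trans (ℤ.+-identityˡ _) (trans (cong (2^ (k ∸ e) *ᶻ_) f)
            (trans (sym (ℤ.*-assoc (2^ (k ∸ e)) (+ u k) (o k)))
              (cong (_*ᶻ o k) (sym (ℤ.pos-* (2 ^ (k ∸ e)) (u k)))))))) s f))

-- The sign is eventually constant, so the absolute value is eventually the sequence or its
-- negative.
regular-∣∣ : ∀ {g} → Regular g → Regular (λ k → + ∣ g k ∣)
regular-∣∣ {g} r with regular-sign r
... | vanishes z = regular-resp (eventually-map (λ p → trans p (cong (λ i → + ∣ i ∣) (sym p))) z) r
... | positive (growth _ _ b) = regular-resp
        (eventually-map (λ (l , _) → sym (ℤ.0≤i⇒+∣i∣≡i (ℤ.≤-trans (+≤+ z≤n) l))) b) r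
... | negative (growth _ _ b) = regular-resp
        (eventually-map (λ {k} (l , _) → sym (trans (cong +_ (sym (ℤ.∣-i∣≡∣i∣ (g k))))
          (ℤ.0≤i⇒+∣i∣≡i (ℤ.≤-trans (+≤+ z≤n) l)))) b) (regular-neg r)

-- The model of germs

-- Representatives are natural at every index, not only eventually, so that sentences true in ℕ
-- apply at each `k`. The germs proper are the classes under `≡ᵍ`.
record Germ : Set where
  constructor germ
  field
    value         : ℕ → ℕ
    value-regular : Regular (λ k → + value k)

open Germ

infixl 6 _+ᵍ_
infixl 7 _*ᵍ_
infix  4 _≡ᵍ_ _≤ᵍ_ _<ᵍ_

_≡ᵍ_ _≤ᵍ_ _<ᵍ_ : Germ → Germ → Set
x ≡ᵍ y = Eventually λ k → value x k ≡ value y k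
x ≤ᵍ y = Eventually λ k → value x k ≤ value y k
x <ᵍ y = Eventually λ k → value x k < value y k

const : ℕ → Germ
const n = germ (λ _ → n) (regular-const (+ n))

_+ᵍ_ _*ᵍ_ : Germ → Germ → Germ
x +ᵍ y = germ (λ k → value x k + value y k)
  (regular-resp (always λ k → sym (ℤ.pos-+ (value x k) (value y k))) (regular-+ (value-regular x) (value-regular y)))
x *ᵍ y = germ (λ k → value x k * value y k)
  (regular-resp (always λ k → sym (ℤ.pos-* (value x k) (value y k))) (regular-* (value-regular x) (value-regular y)))

monomialGerm : ∀ {u} → Monomial u → Germ
monomialGerm {u} m = germ u (monomial-regular m)

data Trichotomy (x y : Germ) : Set where
  lt : x <ᵍ y → Trichotomy x y
  eq : x ≡ᵍ y → Trichotomy x y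
  gt : y <ᵍ x → Trichotomy x y

difference : Germ → Germ → ℕ → ℤ
difference x y k = + value x k +ᶻ -ᶻ (+ value y k)

difference-regular : ∀ x y → Regular (difference x y)
difference-regular x y = regular-+ (value-regular x) (regular-neg (value-regular y))

-- The eventual sign of the difference decides order and equality constructively; stability of the
-- atoms and transfer both rest on this.
compare : ∀ x y → Trichotomy x y
compare x y with regular-sign (difference-regular x y)
... | vanishes z = eq (eventually-map (λ p → ℤ.+-injective (ℤ.i-j≡0⇒i≡j _ _ p)) z)
... | positive (growth _ m b) = gt (eventually-zip (λ (l , _) 1≤u → larger (ℤ.≤-trans (+≤+ 1≤u) l))
        b (monomial-positive m))
  where
  larger : ∀ {m n} → 1ℤ ≤ᶻ + m +ᶻ -ᶻ (+ n) → n < m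
  larger {m} {n} p = ℤ.drop‿+≤+ (ℤ.≤-trans (ℤ.+-monoˡ-≤ (+ n) p) (ℤ.≤-reflexive (cancel (+ m) (+ n))))
    where
    cancel : ∀ i j → i +ᶻ -ᶻ j +ᶻ j ≡ i
    cancel = solve-∀
... | negative (growth _ m b) = lt (eventually-zip (λ (l , _) 1≤u → smaller (ℤ.≤-trans (+≤+ 1≤u) l))
        b (monomial-positive m))
  where
  smaller : ∀ {m n} → 1ℤ ≤ᶻ -ᶻ (+ m +ᶻ -ᶻ (+ n)) → m < n
  smaller {m} {n} p = ℤ.drop‿+≤+ (ℤ.≤-trans (ℤ.+-monoˡ-≤ (+ m) p) (ℤ.≤-reflexive (cancel (+ m) (+ n))))
    where
    cancel : ∀ i j → -ᶻ (i +ᶻ -ᶻ j) +ᶻ i ≡ j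
    cancel = solve-∀

never : ∀ {P : ℕ → Set} → (∀ {k} → ¬ P k) → ¬ Eventually P
never ¬p p = ¬p (proj₂ (witness p))

-- By trichotomy no germ oscillates around `n`: below `suc n` it eventually equals `n` or eventually
-- stays below `n`.
bounded⇒constant : ∀ n r → r <ᵍ const n → ∃ λ c → r ≡ᵍ const c
bounded⇒constant zero    r r<0 = contradiction r<0 (never λ ())
bounded⇒constant (suc n) r r<1+n with compare r (const n)
... | lt r<n = bounded⇒constant n r r<n
... | eq r≡n = n , r≡n
... | gt n<r = contradiction (r<1+n & n<r) (never λ { (s≤s r≤n , n<r) → ℕ.<⇒≱ n<r r≤n })

-- The absolute difference is regular by `regular-∣∣`, and it agrees with truncated subtraction when
-- `y ≤ᵍ x`.
_∸ᵍ_ : Germ → Germ → Germ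
x ∸ᵍ y = germ (λ k → ∣ difference x y k ∣) (regular-∣∣ (difference-regular x y))

y+[x∸y]≡x : ∀ x y → y ≤ᵍ x → x ≡ᵍ y +ᵍ (x ∸ᵍ y)
y+[x∸y]≡x x y = eventually-map λ y≤x → trans (sym (ℕ.m+[n∸m]≡n y≤x))
  (cong (λ d → value y _ + d) (sym (cong ∣_∣ (trans (ℤ.m-n≡m⊖n (value x _) (value y _)) (ℤ.⊖-≥ y≤x)))))

germ-oddPart : ∀ x → x ≡ᵍ const 0 ⊎
  Σ (ℕ → ℕ) λ u → Monomial u × Σ Germ λ h →
    Eventually (λ k → Odd (value h k)) × Eventually (λ k → value x k ≡ u k * value h k)
germ-oddPart x with poly-oddPart (proj₂ (witness (value-regular x)))
... | inj₁ z = inj₁ (eventually-map ℤ.+-injective z)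
... | inj₂ (oddPart {u} {o} m r odd f) = inj₂ (u , m , germ (λ k → ∣ o k ∣) (regular-∣∣ r) , odd ,
        eventually-map (λ {k} f → trans (cong ∣_∣ f) (ℤ.abs-* (+ u k) (o k))) f)

-- Germs that are powers of two

odd-3 : Odd 3
odd-3 = toWitnessFalse {a? = 2 ∣? 3} _

odd∣2^⇒≡1 : ∀ {o} n → Odd o → o ∣ 2 ^ n → o ≡ 1
odd∣2^⇒≡1 zero    odd o∣1 = ∣1⇒≡1 o∣1
odd∣2^⇒≡1 (suc n) odd o∣  = odd∣2^⇒≡1 n odd (coprime-divisor coprime o∣)
  where
  coprime : ∀ {d} → (d ∣ _) × (d ∣ 2) → d ≡ 1
  coprime (d∣o , d∣2) with prime⇒irreducible prime[2] d∣2
  ... | inj₁ d≡1  = d≡1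
  ... | inj₂ refl = contradiction d∣o odd

monomial-resp : ∀ {u v} → Eventually (λ k → u k ≡ v k) → Monomial u → Monomial v
monomial-resp u≡v (monomial a p q i u≡ a≡) =
  monomial a p q i (eventually-zip (λ u≡v u≡ → trans (sym u≡v) u≡) u≡v u≡) a≡

2^-cancel-≤ : ∀ {m n} → 2 ^ m ≤ 2 ^ n → m ≤ n
2^-cancel-≤ p = ℕ.≮⇒≥ λ n<m → ℕ.<⇒≱ (ℕ.^-monoʳ-< 2 (s≤s (s≤s z≤n)) n<m) p

-- A value above `1` forces a positive exponent, so lowering the exponent by one does not truncate.
monomial-half : ∀ {u} → Monomial u → Eventually (λ k → 1 < u k) →
                Σ (ℕ → ℕ) λ v → Monomial v × Eventually (λ k → v k * 2 ≡ u k)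
monomial-half {u} (monomial a p q i u≡ a≡) 1<u = (λ k → 2 ^ (a k ∸ 1)) ,
  monomial (λ k → a k ∸ 1) (suc p) q i (always λ _ → refl)
    (eventually-zip (λ {k} 1≤a a≡ → trans (ℕ.+-suc (a k ∸ 1) p) (trans (cong (_+ p) (ℕ.m+[n∸m]≡n 1≤a)) a≡)) 1≤a a≡) ,
  eventually-zip (λ {k} 1≤a u≡ → trans (ℕ.*-comm (2 ^ (a k ∸ 1)) 2)
    (trans (cong (2 ^_) (ℕ.m+[n∸m]≡n 1≤a)) (sym u≡))) 1≤a u≡
  where
  1≤a : Eventually (λ k → 1 ≤ a k)
  1≤a = eventually-zip (λ 1<u u≡ → 2^-cancel-≤ (ℕ.≤-trans 1<u (ℕ.≤-reflexive u≡))) 1<u u≡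

-- Exponents subtract, and `u ≤ v` makes the difference natural. For it to be affine with a natural
-- slope, the slopes must be ordered as well.
monomial-quotient : ∀ {u v} → Monomial u → Monomial v → Eventually (λ k → u k ≤ v k) →
                    Σ (ℕ → ℕ) λ w → Monomial w × Eventually (λ k → w k * u k ≡ v k)
monomial-quotient {u} {v} (monomial a p q i u≡ a≡) (monomial b p′ q′ j v≡ b≡) u≤v =
  (λ k → 2 ^ (b k ∸ a k)) ,
  monomial (λ k → b k ∸ a k) (q + p′) (q′ + p) (j ∸ i) (always λ _ → refl)
    (eventually-map (λ {k} → affine k) balance) ,
  eventually-zip (λ {k} a≤b (u≡ , v≡) → trans (cong (2 ^ (b k ∸ a k) *_) u≡)
    (trans (sym (ℕ.^-distribˡ-+-* 2 (b k ∸ a k) (a k))) (trans (cong (2 ^_) (ℕ.m∸n+n≡m a≤b)) (sym v≡))))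
    a≤b (u≡ & v≡)
  where
  open ≡-Reasoning
  a≤b : Eventually (λ k → a k ≤ b k)
  a≤b = eventually-zip (λ u≤v (u≡ , v≡) → 2^-cancel-≤
    (ℕ.≤-trans (ℕ.≤-reflexive (sym u≡)) (ℕ.≤-trans u≤v (ℕ.≤-reflexive v≡)))) u≤v (u≡ & v≡)

  -- The difference of the two affine equations, with `i * k` kept on the left because `i ≤ j` is
  -- not yet known.
  balance : Eventually (λ k → b k ∸ a k + (q + p′) + i * k ≡ q′ + p + j * k)
  balance = eventually-zip (λ {k} a≤b (a≡ , b≡) → begin
    b k ∸ a k + (q + p′) + i * k        ≡⟨ swap (b k ∸ a k) q p′ (i * k) ⟩
    b k ∸ a k + (q + i * k) + p′        ≡⟨ cong (λ l → b k ∸ a k + l + p′) a≡ ⟨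
    b k ∸ a k + (a k + p) + p′          ≡⟨ swap′ (b k ∸ a k) (a k) p p′ ⟩
    b k ∸ a k + a k + p′ + p            ≡⟨ cong (λ l → l + p′ + p) (ℕ.m∸n+n≡m a≤b) ⟩
    b k + p′ + p                        ≡⟨ cong (_+ p) b≡ ⟩
    q′ + j * k + p                      ≡⟨ swap″ q′ (j * k) p ⟩
    q′ + p + j * k                      ∎) a≤b (a≡ & b≡)
    where
    swap : ∀ d q p′ l → d + (q + p′) + l ≡ d + (q + l) + p′
    swap = ℕ-Solver.solve-∀
    swap′ : ∀ d a p p′ → d + (a + p) + p′ ≡ d + a + p′ + p
    swap′ = ℕ-Solver.solve-∀
    swap″ : ∀ q l p → q + l + p ≡ q + p + l
    swap″ = ℕ-Solver.solve-∀

  -- For `j < i` the identity `balance` would bound `k` by `q′ + p`.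
  i≤j : i ≤ j
  i≤j = ℕ.≮⇒≥ λ j<i → never (λ {k} (e , c<k) → ℕ.<⇒≱ c<k (bound k j<i e))
      (balance & ≥-eventually (suc (q′ + p)))
    where
    bound : ∀ k → j < i → b k ∸ a k + (q + p′) + i * k ≡ q′ + p + j * k → k ≤ q′ + p
    bound k j<i e = ℕ.+-cancelʳ-≤ (j * k) k (q′ + p)
      (ℕ.≤-trans (ℕ.*-monoˡ-≤ k j<i) (ℕ.≤-trans (ℕ.m≤n+m (i * k) (b k ∸ a k + (q + p′))) (ℕ.≤-reflexive e)))

  affine : ∀ k → b k ∸ a k + (q + p′) + i * k ≡ q′ + p + j * k →
           b k ∸ a k + (q + p′) ≡ q′ + p + (j ∸ i) * k
  affine k e = ℕ.+-cancelʳ-≡ (i * k) _ _ (trans e (trans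
    (cong (λ l → q′ + p + l * k) (sym (ℕ.m∸n+n≡m i≤j))) (regroup (q′ + p) (j ∸ i) i k)))
    where
    regroup : ∀ c d i k → c + (d + i) * k ≡ c + d * k + i * k
    regroup = ℕ-Solver.solve-∀

infix 4 _∣ᵍ_
_∣ᵍ_ : Germ → Germ → Set
x ∣ᵍ y = Σ Germ λ z → z *ᵍ x ≡ᵍ y

-- The interpretation of pow₂ in NegativeSemantics.
IsPow₂ : Germ → Set
IsPow₂ x = ∀ y → ¬ ¬ (y ∣ᵍ x) → ¬ ¬ (y ≡ᵍ const 1 ⊎ ¬ ¬ (const 2 ∣ᵍ y))

-- The odd part of a divisor `y` divides `2 ^ a k`, so it is `1` and `y` is itself a monomial.
-- Pointwise evenness would not suffice: half of `y` has to be a germ again, and `monomial-half`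
-- provides it.
monomial⇒pow₂ : ∀ x → Monomial (value x) → IsPow₂ x
monomial⇒pow₂ x m@(monomial a _ _ _ x≡ _) y = ¬¬-map analyse
  where
  zero-case : ∀ {k} (z : Germ) → value z k * value y k ≡ value x k → 1 ≤ value x k → ¬ value y k ≡ 0
  zero-case z zy≡x 1≤x y≡0 = ℕ.<⇒≢ 1≤x (trans (sym (ℕ.*-zeroʳ (value z _)))
    (trans (cong (value z _ *_) (sym y≡0)) zy≡x))

  analyse : y ∣ᵍ x → y ≡ᵍ const 1 ⊎ ¬ ¬ (const 2 ∣ᵍ y)
  analyse (z , zy≡x) with compare y (const 1)
  ... | eq y≡1 = inj₁ y≡1
  ... | lt y<1 = contradiction (zy≡x & monomial-positive m & y<1)
          (never λ { ((zy≡x , 1≤x) , y<1) → zero-case z zy≡x 1≤x (ℕ.n<1⇒n≡0 y<1) })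
  ... | gt 1<y with germ-oddPart y
  ...   | inj₁ y≡0 = contradiction (1<y & y≡0) (never λ { (1<y , y≡0) → ℕ.<⇒≢ (ℕ.<⇒≤ 1<y) (sym y≡0) })
  ...   | inj₂ (u , μ , h , odd , y≡uh) = inj₂ (contradiction
            (monomialGerm (proj₁ (proj₂ half)) , proj₂ (proj₂ half)))
    where
    h≡1 : ∀ {k} → value z k * value y k ≡ value x k → value x k ≡ 2 ^ a k →
          Odd (value h k) → value y k ≡ u k * value h k → value h k ≡ 1
    h≡1 {k} zy≡x x≡2^a odd y≡uh = odd∣2^⇒≡1 (a k) odd (divides (value z k * u k)
      (trans (sym x≡2^a) (trans (sym zy≡x) (trans (cong (value z k *_) y≡uh) (sym (ℕ.*-assoc (value z k) _ _))))))

    y≡u : Eventually (λ k → value y k ≡ u k)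
    y≡u = eventually-zip
      (λ (zy≡x , x≡) (odd , y≡uh) → trans y≡uh (trans (cong (u _ *_) (h≡1 zy≡x x≡ odd y≡uh)) (ℕ.*-identityʳ _)))
      (zy≡x & x≡) (odd & y≡uh)

    half = monomial-half (monomial-resp (eventually-map sym y≡u) μ) 1<y

-- The hypothesis is tested on a single divisor, the odd part of `x`: not being even, it must be
-- `1`, which leaves the monomial.
pow₂⇒monomial : ∀ x → IsPow₂ x → ¬ ¬ Monomial (value x)
pow₂⇒monomial x pow with germ-oddPart x
-- Zero is excluded by its divisor `3`, which is neither `1` nor even.
... | inj₁ x≡0 = ¬¬-map
        [ (λ 3≡1 → contradiction 3≡1 (never λ ()))
        , (λ 2∣3 → contradiction (λ { (z , 2z≡3) → never (λ {k} e → odd-3 (divides (value z k) (sym e))) 2z≡3 }) 2∣3) ]′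
        (pow (const 3) (contradiction (const 0 , eventually-map sym x≡0)))
... | inj₂ (u , μ , h , odd , x≡uh) = ¬¬-map
        [ (λ h≡1 → monomial-resp (eventually-zip (λ x≡uh h≡1 →
            sym (trans x≡uh (trans (cong (u _ *_) h≡1) (ℕ.*-identityʳ _)))) x≡uh h≡1) μ)
        , (λ 2∣h → contradiction (λ { (z , 2z≡h) → never (λ { {k} (odd , e) → odd (divides (value z k) (sym e)) }) (odd & 2z≡h) }) 2∣h) ]′
        (pow h (contradiction (monomialGerm μ , eventually-map sym x≡uh)))

pow₂-total : ∀ x y → IsPow₂ x → IsPow₂ y → x ≤ᵍ y → ¬ ¬ (x ∣ᵍ y)
pow₂-total x y px py x≤y ¬x∣y = pow₂⇒monomial x px λ mx → pow₂⇒monomial y py λ my →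
  let _ , mw , wx≡y = monomial-quotient mx my x≤y in ¬x∣y (monomialGerm mw , wx≡y)

germ-growth : ∀ x → const 1 ≤ᵍ x → Growth (λ k → + value x k)
germ-growth x 1≤x with regular-sign (value-regular x)
... | positive γ = γ
... | vanishes z = contradiction (1≤x & z) (never λ { (1≤x , z) → ℕ.<⇒≢ 1≤x (sym (ℤ.+-injective z)) })
... | negative (growth _ m b) = contradiction (1≤x & b) (never λ (1≤x , l , _) → below 1≤x l)
  where
  below : ∀ {m n} → 1 ≤ n → ¬ (+ m ≤ᶻ -ᶻ (+ n))
  below (s≤s _) ()

leading-power : ∀ x → const 1 ≤ᵍ x → Σ Germ λ u → Monomial (value u) × u ≤ᵍ x × x <ᵍ const 2 *ᵍ u
leading-power x 1≤x with germ-growth x 1≤x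
-- Since `B < 2 ^ B`, the ratio `B` can serve as the bound on the number of doublings.
... | growth {u} B m b = search B (monomialGerm m) m
        (eventually-map (λ (l , _) → ℤ.drop‿+≤+ l) b)
        (eventually-zip (λ (_ , r) 1≤u → above r 1≤u) b (monomial-positive m))
  where
  above : ∀ {n u} → + n ≤ᶻ + B *ᶻ + u → 1 ≤ u → n < 2 ^ B * u
  above {u = u} r 1≤u = ℕ.≤-<-trans (ℤ.drop‿+≤+ (ℤ.≤-trans r (ℤ.≤-reflexive (sym (ℤ.pos-* B u)))))
    (ℕ.*-monoˡ-< u {{>-nonZero 1≤u}} (n<2^n B))

  -- Invariant: `u ≤ x < 2^c u`. Doubling `u` lowers `c`, and `c = 0` is contradictory.
  search : ∀ c u → Monomial (value u) → u ≤ᵍ x → x <ᵍ const (2 ^ c) *ᵍ u →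
           Σ Germ λ u → Monomial (value u) × u ≤ᵍ x × x <ᵍ const 2 *ᵍ u
  search zero    u m u≤x x<u = contradiction (u≤x & x<u)
    (never λ { {k} (u≤x , x<u) → ℕ.<⇒≱ x<u (ℕ.≤-trans (ℕ.≤-reflexive (ℕ.*-identityˡ (value u k))) u≤x) })
  search (suc c) u m u≤x x<2^u = decide (compare x (const 2 *ᵍ u))
    where
    regroup : ∀ t u → 2 * t * u ≡ t * (2 * u)
    regroup = ℕ-Solver.solve-∀

    double : const 2 *ᵍ u ≤ᵍ x → Σ Germ λ u → Monomial (value u) × u ≤ᵍ x × x <ᵍ const 2 *ᵍ u
    double 2u≤x = search c (const 2 *ᵍ u) (monomial-* (monomial-2^ 1) m) 2u≤x
      (eventually-map (λ {k} → ≡.subst (value x k <_) (regroup (2 ^ c) (value u k))) x<2^u)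

    decide : Trichotomy x (const 2 *ᵍ u) → Σ Germ λ u → Monomial (value u) × u ≤ᵍ x × x <ᵍ const 2 *ᵍ u
    decide (lt x<2u) = u , m , u≤x , x<2u
    decide (eq x≡2u) = double (eventually-map (ℕ.≤-reflexive ∘ sym) x≡2u)
    decide (gt 2u<x) = double (eventually-map ℕ.<⇒≤ 2u<x)

-- The germs as a stable structure

≡ᵍ-stable : ∀ x y → Stable (x ≡ᵍ y)
≡ᵍ-stable x y ¬¬x≡y with compare x y
... | eq x≡y = x≡y
... | lt x<y = contradiction (λ x≡y → never (λ (p , q) → ℕ.<⇒≢ p q) (x<y & x≡y)) ¬¬x≡y
... | gt y<x = contradiction (λ x≡y → never (λ (p , q) → ℕ.<⇒≢ p (sym q)) (y<x & x≡y)) ¬¬x≡y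

≤ᵍ-stable : ∀ x y → Stable (x ≤ᵍ y)
≤ᵍ-stable x y ¬¬x≤y with compare x y
... | eq x≡y = eventually-map ℕ.≤-reflexive x≡y
... | lt x<y = eventually-map ℕ.<⇒≤ x<y
... | gt y<x = contradiction (λ x≤y → never (λ (p , q) → ℕ.<⇒≱ p q) (y<x & x≤y)) ¬¬x≤y

𝔊 : StableStructure
𝔊 = record
  { Carrier       = Germ
  ; 0#            = const 0
  ; 1#            = const 1
  ; _⊞_           = _+ᵍ_
  ; _⊠_           = _*ᵍ_
  ; _≐_           = _≡ᵍ_
  ; _⊑_           = _≤ᵍ_
  ; isEquivalence = record
    { refl  = always λ _ → refl
    ; sym   = eventually-map sym
    ; trans = eventually-zip trans
    }
  ; ⊞-cong        = eventually-zip (cong₂ _+_)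
  ; ⊠-cong        = eventually-zip (cong₂ _*_)
  ; ⊑-resp-≐      = λ a≡b c≡d a≤c →
      eventually-zip (λ (p , q) → ≡.subst₂ _≤_ p q) (a≡b & c≡d) a≤c
  ; ≐-stable      = λ {x} {y} → ≡ᵍ-stable x y
  ; ⊑-stable      = λ {x} {y} → ≤ᵍ-stable x y
  }

-- Transfer of universal sentences

module 𝔊 = NegativeSemantics 𝔊
module 𝔑 = Semantics 𝔑₀

⟦⟧ₜ-value : ∀ {n} (t : Term n) {ρ σ k} → (∀ i → σ i ≡ value (ρ i) k) → 𝔑.⟦ t ⟧ₜ σ ≡ value (𝔊.⟦ t ⟧ₜ ρ) k
⟦⟧ₜ-value (var i) σ≡ = σ≡ i
⟦⟧ₜ-value 𝟘       σ≡ = refl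
⟦⟧ₜ-value 𝟙       σ≡ = refl
⟦⟧ₜ-value (s ⊕ t) σ≡ = cong₂ _+_ (⟦⟧ₜ-value s σ≡) (⟦⟧ₜ-value t σ≡)
⟦⟧ₜ-value (s ∙ t) σ≡ = cong₂ _*_ (⟦⟧ₜ-value s σ≡) (⟦⟧ₜ-value t σ≡)

-- `false` asks for falsity at all large `k`, which is stronger than failure of eventual truth;
-- disjunction and implication need this form.
data Settled {n} (φ : Formula n) (ρ : 𝔊.Env n) (σ : ℕ → 𝔑.Env n) : Set where
  true  :   𝔊.⟦ φ ⟧ ρ → Eventually (λ k →   𝔑.⟦ φ ⟧ (σ k)) → Settled φ ρ σ
  false : ¬ 𝔊.⟦ φ ⟧ ρ → Eventually (λ k → ¬ 𝔑.⟦ φ ⟧ (σ k)) → Settled φ ρ σ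

module _ {n} {ρ : 𝔊.Env n} {σ : ℕ → 𝔑.Env n} (σ≡ : ∀ k i → σ k i ≡ value (ρ i) k) where
  pointwise : ∀ (R : ℕ → ℕ → Set) s t →
              Eventually (λ k → R (value (𝔊.⟦ s ⟧ₜ ρ) k) (value (𝔊.⟦ t ⟧ₜ ρ) k)) →
              Eventually (λ k → R (𝔑.⟦ s ⟧ₜ (σ k)) (𝔑.⟦ t ⟧ₜ (σ k)))
  pointwise R s t = eventually-map
    (λ {k} → ≡.subst₂ R (sym (⟦⟧ₜ-value s (σ≡ k))) (sym (⟦⟧ₜ-value t (σ≡ k))))

  -- A quantifier-free Łoś theorem for the cofinite filter. This is no ultrafilter, but `compare`
  -- settles the atoms and the connectives preserve being settled.
  settle : ∀ {φ : Formula n} → QuantifierFree φ → Settled φ ρ σ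
  settle (qf-≈ {s} {t}) with compare (𝔊.⟦ s ⟧ₜ ρ) (𝔊.⟦ t ⟧ₜ ρ)
  ... | lt s<t = false (λ s≡t → never (λ (p , q) → ℕ.<⇒≢ p q) (s<t & s≡t))
                       (pointwise _≢_ s t (eventually-map ℕ.<⇒≢ s<t))
  ... | eq s≡t = true s≡t (pointwise _≡_ s t s≡t)
  ... | gt t<s = false (λ s≡t → never (λ (p , q) → ℕ.<⇒≢ p (sym q)) (t<s & s≡t))
                       (pointwise _≢_ s t (eventually-map (λ p q → ℕ.<⇒≢ p (sym q)) t<s))
  settle (qf-≼ {s} {t}) with compare (𝔊.⟦ s ⟧ₜ ρ) (𝔊.⟦ t ⟧ₜ ρ)
  ... | lt s<t = true (eventually-map ℕ.<⇒≤ s<t) (pointwise _≤_ s t (eventually-map ℕ.<⇒≤ s<t))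
  ... | eq s≡t = true (eventually-map ℕ.≤-reflexive s≡t) (pointwise _≤_ s t (eventually-map ℕ.≤-reflexive s≡t))
  ... | gt t<s = false (λ s≤t → never (λ (p , q) → ℕ.<⇒≱ p q) (t<s & s≤t))
                       (pointwise _≰_ s t (eventually-map ℕ.<⇒≱ t<s))
  settle qf-⊥ = false (λ ()) (always λ _ ())
  settle (qf-∧ φ ψ) with settle φ | settle ψ
  ... | true p p′   | true q q′   = true (p , q) (p′ & q′)
  ... | true _ _    | false ¬q q′ = false (¬q ∘ proj₂) (eventually-map (_∘ proj₂) q′)
  ... | false ¬p p′ | _           = false (¬p ∘ proj₁) (eventually-map (_∘ proj₁) p′)
  settle (qf-∨ φ ψ) with settle φ | settle ψ
  ... | true p p′   | _           = true (contradiction (inj₁ p)) (eventually-map inj₁ p′)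
  ... | false _ _   | true q q′   = true (contradiction (inj₂ q)) (eventually-map inj₂ q′)
  ... | false ¬p p′ | false ¬q q′ = false (λ ¬¬p⊎q → ¬¬p⊎q [ ¬p , ¬q ]′)
                                          (eventually-zip (λ ¬p ¬q → [ ¬p , ¬q ]′) p′ q′)
  settle (qf-⇒ φ ψ) with settle φ | settle ψ
  ... | _           | true q q′   = true (λ _ → q) (eventually-map (λ q _ → q) q′)
  ... | false ¬p p′ | false _ _   = true (λ p → contradiction p ¬p) (eventually-map (λ ¬p p → contradiction p ¬p) p′)
  ... | true p p′   | false ¬q q′ = false (λ f → ¬q (f p)) (eventually-zip (λ p ¬q f → ¬q (f p)) p′ q′)

-- A quantifier over germs is instantiated at index `k` by the `k`-th value of the germ. The matrix
-- then holds at every `k`, so it cannot be settled as false.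
universal-transfer : ∀ {n} {φ : Formula n} → Universal φ → ∀ {ρ : 𝔊.Env n} {σ : ℕ → 𝔑.Env n} →
                     (∀ k i → σ k i ≡ value (ρ i) k) → (∀ k → 𝔑.⟦ φ ⟧ (σ k)) → 𝔊.⟦ φ ⟧ ρ
universal-transfer (matrix qf) σ≡ h with settle σ≡ qf
... | true p _   = p
... | false _ ¬h = contradiction (proj₂ (witness ¬h)) (λ ¬φ → ¬φ (h _))
universal-transfer (all u) σ≡ h a = universal-transfer u
  (λ { k zero → refl ; k (suc i) → σ≡ k i }) (λ k → h k (value a k))

Th∀-holds : ∀ {φ} → Th∀ 𝔑₀ φ → 𝔊.⟦ φ ⟧ Vector.[]
Th∀-holds (u , h) = universal-transfer u {σ = λ _ → Vector.[]} (λ _ ()) (λ _ → h)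

-- The axioms hold for germs

PA⁻smu-holds : ∀ {φ} → PA⁻smu φ → 𝔊.⟦ φ ⟧ Vector.[]
PA⁻smu-holds pa1  x     = always λ k → ℕ.+-identityʳ (value x k)
-- The outermost quantifier of `∀*` binds the variable of highest index, so the arguments arrive in
-- reverse order.
PA⁻smu-holds pa2  y x   = always λ k → ℕ.+-comm (value x k) (value y k)
PA⁻smu-holds pa3  z y x = always λ k → ℕ.+-assoc (value x k) (value y k) (value z k)
PA⁻smu-holds pa4  x     = always λ k → ℕ.*-identityʳ (value x k)
PA⁻smu-holds pa5  y x   = always λ k → ℕ.*-comm (value x k) (value y k)
PA⁻smu-holds pa6  z y x = always λ k → ℕ.*-assoc (value x k) (value y k) (value z k)
PA⁻smu-holds pa7  z y x = always λ k → ℕ.*-distribˡ-+ (value x k) (value y k) (value z k)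
PA⁻smu-holds pa8  y x   with compare x y
... | lt x<y = contradiction (inj₁ (eventually-map ℕ.<⇒≤ x<y))
... | eq x≡y = contradiction (inj₁ (eventually-map ℕ.≤-reflexive x≡y))
... | gt y<x = contradiction (inj₂ (eventually-map ℕ.<⇒≤ y<x))
PA⁻smu-holds pa9  z y x = λ (x≤y , y≤z) → eventually-zip ℕ.≤-trans x≤y y≤z
PA⁻smu-holds pa10 x     = never λ {k} p → ℕ.m+1+n≰m (value x k) p
PA⁻smu-holds pa11 y x y≤x with compare y x
... | lt y<x = contradiction (inj₂ (eventually-map (λ {k} → ≡.subst (_≤ value x k) (ℕ.+-comm 1 (value y k))) y<x))
... | eq y≡x = contradiction (inj₁ y≡x)
... | gt x<y = contradiction (x<y & y≤x) (never λ (p , q) → ℕ.<⇒≱ p q)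
PA⁻smu-holds pa12 z y x = eventually-map (λ {k} → ℕ.+-monoˡ-≤ (value z k))
PA⁻smu-holds pa13 z y x = eventually-map (λ {k} → ℕ.*-monoˡ-≤ (value z k))
PA⁻smu-holds pa15 y x y≤x = contradiction (x ∸ᵍ y , y+[x∸y]≡x x y y≤x)
PA⁻smu-holds pa19 x     =
  let u , m , u≤1+x , 1+x<2u = leading-power (x +ᵍ const 1) (always λ k → ℕ.m≤n+m 1 (value x k))
  in contradiction (u , monomial⇒pow₂ u m , u≤1+x , eventually-map ℕ.<⇒≤ 1+x<2u ,
       λ 1+x≡2u → never (λ (p , q) → ℕ.<⇒≢ p q) (1+x<2u & 1+x≡2u))
PA⁻smu-holds pa20 y x (px , py , x≤y) = pow₂-total x y px py x≤y

-- Failure of division by three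

pa16₃-fails : ¬ 𝔊.⟦ pa16₃ ⟧ Vector.[]
-- The dividend is the germ of `2 ^ k`.
pa16₃-fails h = h (monomialGerm (monomial-2^∸ 0)) λ (q , ¬¬r) → ¬¬r λ (r , (r≤3 , r≢3) , 2^k≡3q+r) →
  refute q r (proper r r≤3 r≢3) 2^k≡3q+r
  where
  -- `≺` gives only `≤` and the negation of eventual equality; trichotomy makes it eventual
  -- strictness.
  proper : ∀ r → r ≤ᵍ const 3 → ¬ r ≡ᵍ const 3 → r <ᵍ const 3
  proper r r≤3 r≢3 with compare r (const 3)
  ... | lt r<3 = r<3
  ... | eq r≡3 = contradiction r≡3 r≢3
  ... | gt 3<r = contradiction (3<r & r≤3) (never λ (p , q) → ℕ.<⇒≱ p q)

  -- 2t and t having the same remainder c forces 3 ∣ c.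
  common-remainder : ∀ {t} c q q′ → t ≡ q * 3 + c → 2 * t ≡ q′ * 3 + c → 3 ∣ t
  common-remainder {t} c q q′ t≡ 2t≡ =
    ≡.subst (3 ∣_) (sym t≡) (∣m∣n⇒∣m+n (n∣m*n q) (∣m+n∣m⇒∣n (divides q′ difference-≡) (n∣m*n (2 * q))))
    where
    regroup : ∀ q c → 2 * q * 3 + c + c ≡ 2 * (q * 3 + c)
    regroup = ℕ-Solver.solve-∀
    difference-≡ : 2 * q * 3 + c ≡ q′ * 3
    difference-≡ = ℕ.+-cancelʳ-≡ c _ _ (trans (regroup q c) (trans (cong (2 *_) (sym t≡)) 2t≡))

  -- From some index `m` on the remainder is a constant `c`. The indices `m` and `suc m` then give
  -- `3 ∣ 2 ^ m`, although `3` is odd and not `1`.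
  refute : ∀ q r → r <ᵍ const 3 → Eventually (λ k → 2 ^ k ≡ value q k * 3 + value r k) → ⊥
  refute q r r<3 e with bounded⇒constant 3 r r<3
  ... | c , r≡c with eventually-zip (λ {k} e r≡c → trans e (cong (λ c → value q k * 3 + c) r≡c)) e r≡c
  ...   | since m h = contradiction (odd∣2^⇒≡1 m odd-3
            (common-remainder c (value q m) (value q (suc m)) (h m ℕ.≤-refl) (h (suc m) (ℕ.n≤1+n m)))) λ ()

corollary11 : ((PA⁻smu ∪ Th∀ 𝔑₀) ⊬ pa16₃)
    × ¬ ((PA⁻smu ∪ Th∀ 𝔑₀) ⊢pa16)
    × ¬ (PA⁻smu ⊢pa16)
-- Each scheme fails at its instance `3`, which is `pa16₃` by computation.
corollary11 = unprovable 𝔊-models , (λ d → unprovable 𝔊-models (d 3)) , (λ d → unprovable PA⁻smu-holds (d 3))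
  where
  𝔊-models : ∀ {φ} → (PA⁻smu ∪ Th∀ 𝔑₀) φ → 𝔊.⟦ φ ⟧ Vector.[]
  𝔊-models = [ PA⁻smu-holds , Th∀-holds ]′

  unprovable : ∀ {T : Theory} → (∀ {φ} → T φ → 𝔊.⟦ φ ⟧ Vector.[]) → T ⊬ pa16₃
  unprovable model d = pa16₃-fails (𝔊.soundness model d {Vector.[]} [])
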